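{- Let $k\ge 1$. Let $f, g_1,\ldots,g_k:(-\infty,0)\to\mathbb{R}$ and $s:[0,\infty)\to\mathbb{R}$ be ordinal decreasing functions that are strictly positive at every point of their domains. Consider the recursive algorithm \[ M(x)=\begin{cases} f(x), & x<0,\\ g_1\bigl(-M(x-g_2(-M(x-\cdots-g_k(-M(x-s(x)))\cdots)))\bigr), & x\ge 0.\end{cases} \] Then for every $x\in\mathbb{R}$ the computation of $M(x)$ halts (i.e. the recursion is well-founded and $M(x)$ is a well-defined real number), and the resulting function $M:\mathbb{R}\to\mathbb{R}$ is ordinal decreasing.
   Context: For $D\subseteq\mathbb{R}$ and $h:D\to\mathbb{R}$, a strictly decreasing sequence $x_1>x_2>x_3>\cdots$ of points of $D$ is called $h$-bad if $h(x_1)>h(x_2)>h(x_3)>\cdots$. The function $h$ is called ordinal decreasing if there is no infinite $h$-bad sequence. -}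

module Defs where

open import Algebra.Bundles using (CommutativeMonoid)
open import Data.Nat.Base as ℕ using (ℕ; suc; _⊔_)
import Data.Nat.Properties as ℕ
open import Data.Product.Base using (Σ; ∃-syntax; _×_; _,_; proj₁)
open import Data.Rational.Base as ℚ using (ℚ; 0ℚ; ½; ∣_∣)
import Data.Rational.Properties as ℚ
open import Data.Unit.Base using (⊤; tt)
open import Data.Vec.Base using (Vec; []; _∷_)
open import Function.Bundles using (Func)
open import Level using (0ℓ)
open import Relation.Binary.Bundles using (Setoid)
import Relation.Binary.Construct.On as On
open import Relation.Binary.PropositionalEquality
  using (_≡_; sym; trans; cong; subst)
open import Relation.Nullary.Negation.Core using (¬_)
open import Relation.Unary using (Pred)

open import Algebra.Properties.AbelianGroup ℚ.+-0-abelianGroup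
  using (⁻¹-anti-homo‿-; //-rightDividesˡ)
open import Algebra.Properties.CommutativeSemigroup
  (CommutativeMonoid.commutativeSemigroup ℚ.+-0-commutativeMonoid)
  using (interchange)

-- Cantor's real numbers: Cauchy sequences of rationals, taken up to the
-- equivalence _≈_.

Eventually : Pred ℕ 0ℓ → Set
Eventually P = ∃[ N ] (∀ n → N ℕ.≤ n → P n)

IsCauchy : (ℕ → ℚ) → Set
IsCauchy a = ∀ ε → 0ℚ ℚ.< ε →
  ∃[ N ] (∀ m n → N ℕ.≤ m → N ℕ.≤ n → ∣ a m ℚ.- a n ∣ ℚ.< ε)

record ℝ : Set where
  constructor mkℝ
  field
    seq    : ℕ → ℚ
    cauchy : IsCauchy seq

open ℝ public

infix 4 _≈_ _<_ _≥_

_≈_ : ℝ → ℝ → Set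
x ≈ y = ∀ ε → 0ℚ ℚ.< ε → Eventually (λ n → ∣ seq x n ℚ.- seq y n ∣ ℚ.< ε)

_<_ : ℝ → ℝ → Set
x < y = ∃[ ε ] (0ℚ ℚ.< ε × Eventually (λ n → seq x n ℚ.+ ε ℚ.≤ seq y n))

_≥_ : ℝ → ℝ → Set
x ≥ y = ¬ (x < y)

half-pos : ∀ {ε} → 0ℚ ℚ.< ε → 0ℚ ℚ.< ½ ℚ.* ε
half-pos {ε} 0<ε =
  subst (ℚ._< ½ ℚ.* ε) (ℚ.*-zeroʳ ½) (ℚ.*-monoʳ-<-pos ½ 0<ε)

half+half : ∀ ε → ½ ℚ.* ε ℚ.+ ½ ℚ.* ε ≡ ε
half+half ε = trans (sym (ℚ.*-distribʳ-+ ε ½ ½)) (ℚ.*-identityˡ ε)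

∣p-p∣≡0 : ∀ p → ∣ p ℚ.- p ∣ ≡ 0ℚ
∣p-p∣≡0 p = cong ∣_∣ (ℚ.+-inverseʳ p)

∣p-q∣≡∣q-p∣ : ∀ p q → ∣ p ℚ.- q ∣ ≡ ∣ q ℚ.- p ∣
∣p-q∣≡∣q-p∣ p q =
  trans (cong ∣_∣ (sym (⁻¹-anti-homo‿- q p))) (ℚ.∣-p∣≡∣p∣ (q ℚ.- p))

add-halves : ∀ {ε} p q → ∣ p ∣ ℚ.< ½ ℚ.* ε → ∣ q ∣ ℚ.< ½ ℚ.* ε →
             ∣ p ℚ.+ q ∣ ℚ.< ε
add-halves {ε} p q p<ε/2 q<ε/2 = ℚ.≤-<-trans (ℚ.∣p+q∣≤∣p∣+∣q∣ p q)
  (subst (∣ p ∣ ℚ.+ ∣ q ∣ ℚ.<_) (half+half ε) (ℚ.+-mono-< p<ε/2 q<ε/2))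

≈-refl : ∀ {x} → x ≈ x
≈-refl {x} ε 0<ε = 0 , λ n _ → subst (ℚ._< ε) (sym (∣p-p∣≡0 (seq x n))) 0<ε

≈-sym : ∀ {x y} → x ≈ y → y ≈ x
≈-sym {x} {y} x≈y ε 0<ε with N , close ← x≈y ε 0<ε = N , λ n N≤n →
  subst (ℚ._< ε) (∣p-q∣≡∣q-p∣ (seq x n) (seq y n)) (close n N≤n)

≈-trans : ∀ {x y z} → x ≈ y → y ≈ z → x ≈ z
≈-trans {x} {y} {z} x≈y y≈z ε 0<ε
  with N₁ , close₁ ← x≈y (½ ℚ.* ε) (half-pos 0<ε)
     | N₂ , close₂ ← y≈z (½ ℚ.* ε) (half-pos 0<ε)
  = N₁ ⊔ N₂ , λ n N≤n →
    subst (λ d → ∣ d ∣ ℚ.< ε) (lemma (seq x n) (seq y n) (seq z n))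
      (add-halves _ _ (close₁ n (ℕ.m⊔n≤o⇒m≤o N₁ N₂ N≤n))
                      (close₂ n (ℕ.m⊔n≤o⇒n≤o N₁ N₂ N≤n)))
  where
  lemma : ∀ p q r → (p ℚ.- q) ℚ.+ (q ℚ.- r) ≡ p ℚ.- r
  lemma p q r = trans (sym (ℚ.+-assoc (p ℚ.- q) q (ℚ.- r)))
                      (cong (ℚ._- r) (//-rightDividesˡ q p))

ℝ-setoid : Setoid 0ℓ 0ℓ
ℝ-setoid = record
  { Carrier       = ℝ
  ; _≈_           = _≈_
  ; isEquivalence = record
    { refl  = λ {x} → ≈-refl {x}
    ; sym   = λ {x} {y} → ≈-sym {x} {y}
    ; trans = λ {x} {y} {z} → ≈-trans {x} {y} {z}
    }
  }

0ℝ : ℝ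
0ℝ = mkℝ (λ _ → 0ℚ) (λ ε 0<ε → 0 , λ _ _ _ _ → 0<ε)

infixl 6 _+_ _-_
infix  8 -_

_+_ : ℝ → ℝ → ℝ
x + y = mkℝ (λ n → seq x n ℚ.+ seq y n) sum-cauchy
  where
  lemma : ∀ p q r s → (p ℚ.- r) ℚ.+ (q ℚ.- s) ≡ (p ℚ.+ q) ℚ.- (r ℚ.+ s)
  lemma p q r s = trans (interchange p (ℚ.- r) q (ℚ.- s))
                        (cong (p ℚ.+ q ℚ.+_) (sym (ℚ.neg-distrib-+ r s)))

  sum-cauchy : IsCauchy (λ n → seq x n ℚ.+ seq y n)
  sum-cauchy ε 0<ε
    with N₁ , close₁ ← cauchy x (½ ℚ.* ε) (half-pos 0<ε)
       | N₂ , close₂ ← cauchy y (½ ℚ.* ε) (half-pos 0<ε)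
    = N₁ ⊔ N₂ , λ m n N≤m N≤n →
      subst (λ d → ∣ d ∣ ℚ.< ε) (lemma (seq x m) (seq y m) (seq x n) (seq y n))
        (add-halves _ _
          (close₁ m n (ℕ.m⊔n≤o⇒m≤o N₁ N₂ N≤m) (ℕ.m⊔n≤o⇒m≤o N₁ N₂ N≤n))
          (close₂ m n (ℕ.m⊔n≤o⇒n≤o N₁ N₂ N≤m) (ℕ.m⊔n≤o⇒n≤o N₁ N₂ N≤n)))

-_ : ℝ → ℝ
- x = mkℝ (λ n → ℚ.- seq x n) neg-cauchy
  where
  lemma : ∀ p q → q ℚ.- p ≡ (ℚ.- p) ℚ.- (ℚ.- q)
  lemma p q = trans (sym (⁻¹-anti-homo‿- p q)) (ℚ.neg-distrib-+ p (ℚ.- q))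

  neg-cauchy : IsCauchy (λ n → ℚ.- seq x n)
  neg-cauchy ε 0<ε with N , close ← cauchy x ε 0<ε = N , λ m n N≤m N≤n →
    subst (λ d → ∣ d ∣ ℚ.< ε) (lemma (seq x m) (seq x n)) (close n m N≤n N≤m)

_-_ : ℝ → ℝ → ℝ
x - y = x + (- y)

Subset : Pred ℝ 0ℓ → Setoid 0ℓ 0ℓ
Subset D = On.setoid {B = Σ ℝ D} ℝ-setoid proj₁

RealFunction : Pred ℝ 0ℓ → Set
RealFunction D = Func (Subset D) ℝ-setoid

Negative NonNegative : Pred ℝ 0ℓ
Negative    x = x < 0ℝ
NonNegative x = x ≥ 0ℝ

module _ {D : Pred ℝ 0ℓ} (h : RealFunction D) where
  open Func h using (to)

  Bad : (ℕ → Σ ℝ D) → Set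
  Bad x = (∀ n → proj₁ (x (suc n)) < proj₁ (x n))
        × (∀ n → to (x (suc n)) < to (x n))

  OrdinalDecreasing : Set
  OrdinalDecreasing = ¬ (∃[ x ] Bad x)

  Positive : Set
  Positive = ∀ x → 0ℝ < to x

module Algorithm {k : ℕ} (f : RealFunction Negative)
                 (gs : Vec (RealFunction Negative) k)
                 (s : RealFunction NonNegative) where

  open Func using (to)

  -- x ⇓ y is call-by-value evaluation: its derivations are the finished
  -- computations of M(x), and y is the value returned.  For x ≥ 0,
  -- Nested x x≥0 (gᵢ ∷ … ∷ gₖ ∷ []) r says that the subexpression
  --   gᵢ(-M(x - gᵢ₊₁(-M(x - ⋯ gₖ(-M(x - s(x))) ⋯))))
  -- evaluates to r; for the empty vector the subexpression is s(x).
  -- Evaluation is stuck if some gᵢ is applied outside its domain.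

  infix 4 _⇓_

  data _⇓_ : ℝ → ℝ → Set
  data Nested (x : ℝ) (x≥0 : NonNegative x) :
              ∀ {n} → Vec (RealFunction Negative) n → ℝ → Set

  data _⇓_ where
    base : ∀ {x} (x<0 : Negative x) → x ⇓ to f (x , x<0)
    step : ∀ {x y} (x≥0 : NonNegative x) → Nested x x≥0 gs y → x ⇓ y

  data Nested x x≥0 where
    innermost : Nested x x≥0 [] (to s (x , x≥0))
    apply     : ∀ {n r m} {g : RealFunction Negative}
                {hs : Vec (RealFunction Negative) n} →
                Nested x x≥0 hs r → x - r ⇓ m → (-m<0 : Negative (- m)) →
                Nested x x≥0 (g ∷ hs) (to g (- m , -m<0))

  Halts : ℝ → Set
  Halts x = ∃[ y ] x ⇓ y

  Computes : RealFunction (λ _ → ⊤) → Set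
  Computes M = ∀ x → x ⇓ to M (x , tt) × (∀ y → x ⇓ y → y ≈ to M (x , tt))

{-# OPTIONS --safe #-}
module Submission where

-- Call x good if M halts at every y ≤ x and no M-bad sequence starts at or
-- below x.  Consider a subexpression r = gᵢ(-m), m = M(x - r′), of the
-- recursive clause, evaluated along x₁ > x₂ > ⋯ with all calls of M at good
-- points, and suppose that r strictly decreases.  By Ramsey's theorem we may
-- assume that m is monotone; since gᵢ is ordinal decreasing, m decreases; since
-- M has no bad sequence at good points, x - r′ increases along a subsequence,
-- so r′ decreases there, and the same argument applies further in, down to s.
-- If some point is not good, then, from the innermost subexpression outwards,
-- there is a point that is not good below which all calls are at good points:
-- otherwise one finds xₙ₊₁ ≤ xₙ - rₙ in [0, ∞), so Σ rₙ converges and some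
-- subsequence of the rₙ > 0 decreases.  But below such a point M halts and has
-- no bad sequence, so that point is good after all.

open import Defs
open import Axiom.ExcludedMiddle using (ExcludedMiddle)
open import Data.Empty using (⊥)
open import Data.Integer.Base as ℤ using (+_)
import Data.Integer.Properties as ℤ
open import Data.Nat.Base as ℕ using (ℕ; zero; suc; _⊔_) renaming (_≤_ to _≤ℕ_)
import Data.Nat.Properties as ℕ
open import Data.Product.Base using (Σ-syntax; ∃-syntax; _×_; _,_; proj₁; proj₂)
open import Data.Rational.Base as ℚ using (ℚ; mkℚ; 0ℚ; 1ℚ; ½; ∣_∣; ↥_)
import Data.Rational.Properties as ℚ
open import Data.Rational.Solver using (module +-*-Solver)
open import Data.Rational.Unnormalised.Base as ℚᵘ using (mkℚᵘ; *≡*; *≤*)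
import Data.Rational.Unnormalised.Properties as ℚᵘ
open import Data.Sum.Base using (_⊎_; inj₁; inj₂)
open import Data.Vec.Base using (Vec; []; _∷_)
open import Data.Vec.Relation.Unary.All using (All; []; _∷_)
open import Function.Base using (_∘_)
open import Function.Bundles using (Func)
open import Level using (0ℓ)
open import Relation.Binary.PropositionalEquality
  using (_≡_; refl; sym; trans; cong; subst; subst₂)
open import Relation.Nullary using (¬_; yes; no; contradiction)
open import Relation.Nullary.Decidable using (decidable-stable)
open +-*-Solver using (solve; _:=_; _:+_; _:*_; _:-_; :-_; con)

-- Order and arithmetic of Cauchy reals

eventually-× : ∀ {P Q : ℕ → Set} → Eventually P → Eventually Q →
          Eventually (λ n → P n × Q n)
eventually-× (M , p) (N , q) = M ⊔ N , λ n le →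
  p n (ℕ.m⊔n≤o⇒m≤o M N le) , q n (ℕ.m⊔n≤o⇒n≤o M N le)

map-eventually : ∀ {P Q : ℕ → Set} → (∀ n → P n → Q n) → Eventually P → Eventually Q
map-eventually f (N , p) = N , λ n le → f n (p n le)

p≤∣p∣ : ∀ p → p ℚ.≤ ∣ p ∣
p≤∣p∣ p with ℚ.≤-total 0ℚ p
... | inj₁ 0≤p = ℚ.≤-reflexive (sym (ℚ.0≤p⇒∣p∣≡p 0≤p))
... | inj₂ p≤0 = ℚ.≤-trans p≤0 (ℚ.0≤∣p∣ p)

p≤p+ε : ∀ p {ε} → 0ℚ ℚ.< ε → p ℚ.≤ p ℚ.+ ε
p≤p+ε p 0<ε = subst (ℚ._≤ (p ℚ.+ _)) (ℚ.+-identityʳ p) (ℚ.+-monoʳ-≤ p (ℚ.<⇒≤ 0<ε))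

<-trans : ∀ x y z → x < y → y < z → x < z
<-trans x y z (ε , 0<ε , x<y) (δ , 0<δ , y<z) =
  ε , 0<ε , map-eventually
    (λ n (p , q) → ℚ.≤-trans p (ℚ.≤-trans (p≤p+ε (seq y n) 0<δ) q))
    (eventually-× x<y y<z)

<-irrefl : ∀ x y → x ≈ y → ¬ (x < y)
<-irrefl x y x≈y (ε , 0<ε , x<y) with N , p ← eventually-× (x≈y ε 0<ε) x<y =
  absurd (seq x N) (seq y N) (proj₁ (p N ℕ.≤-refl)) (proj₂ (p N ℕ.≤-refl))
  where
  absurd : ∀ a b → ∣ a ℚ.- b ∣ ℚ.< ε → a ℚ.+ ε ℚ.≤ b → ⊥
  absurd a b close apart = ℚ.<-irrefl refl (ℚ.<-≤-trans
    (subst₂ ℚ._<_ (solve 2 (λ a b → a :+ (b :- a) := b) refl a b) refl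
      (ℚ.+-monoʳ-< a (ℚ.≤-<-trans (p≤∣p∣ (b ℚ.- a))
        (subst (ℚ._< ε) (∣p-q∣≡∣q-p∣ a b) close)))) apart)

≥-refl : ∀ x → x ≥ x
≥-refl x = <-irrefl x x (≈-refl {x})

-- If xₙ and yₙ are ε apart and both sequences have settled to within ε/4,
-- then they stay ε/2 apart.
separated : ∀ {ε} a b a′ b′ → ε ℚ.≤ b ℚ.- a →
            ∣ b ℚ.- b′ ∣ ℚ.< ½ ℚ.* (½ ℚ.* ε) → ∣ a′ ℚ.- a ∣ ℚ.< ½ ℚ.* (½ ℚ.* ε) →
            a′ ℚ.+ ½ ℚ.* ε ℚ.≤ b′
separated {ε} a b a′ b′ far b-close a-close = subst₂ ℚ._≤_
  (trans (cong (λ e → a′ ℚ.+ e ℚ.- ½ ℚ.* ε) (sym (half+half ε)))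
         (solve 2 (λ a′ h → a′ :+ (h :+ h) :- h := a′ :+ h) refl a′ (½ ℚ.* ε)))
  (solve 4 (λ a b a′ b′ → a′ :+ (b :- a) :- ((b :- b′) :+ (a′ :- a)) := b′)
     refl a b a′ b′)
  (ℚ.+-mono-≤ (ℚ.+-monoʳ-≤ a′ far)
    (ℚ.neg-antimono-≤ (ℚ.<⇒≤ (ℚ.≤-<-trans (p≤∣p∣ _)
      (add-halves (b ℚ.- b′) (a′ ℚ.- a) b-close a-close)))))

-- A gap of at least `ε` at one index beyond both Cauchy bounds for ε/4 persists at all later
-- indices with half its size, and so would witness `x < y` or `y < x`.
≮∧≯⇒≈ : ∀ x y → ¬ (x < y) → ¬ (y < x) → x ≈ y
≮∧≯⇒≈ x y x≮y y≮x ε 0<ε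
  with M , p ← cauchy x (½ ℚ.* (½ ℚ.* ε)) (half-pos (half-pos 0<ε))
     | N , q ← cauchy y (½ ℚ.* (½ ℚ.* ε)) (half-pos (half-pos 0<ε))
  = M ⊔ N , close
  where
  close : ∀ n → M ⊔ N ≤ℕ n → ∣ seq x n ℚ.- seq y n ∣ ℚ.< ε
  close n le with ∣ seq x n ℚ.- seq y n ∣ ℚ.<? ε
  ... | yes lt = lt
  ... | no ≮ε with ℚ.∣p∣≡p∨∣p∣≡-p (seq x n ℚ.- seq y n)
  ...   | inj₁ eq = contradiction
    (½ ℚ.* ε , half-pos 0<ε , M ⊔ N , λ m le′ →
      separated (seq y n) (seq x n) (seq y m) (seq x m)
        (subst (ε ℚ.≤_) eq (ℚ.≮⇒≥ ≮ε))
        (p n m (ℕ.m⊔n≤o⇒m≤o M N le) (ℕ.m⊔n≤o⇒m≤o M N le′))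
        (q m n (ℕ.m⊔n≤o⇒n≤o M N le′) (ℕ.m⊔n≤o⇒n≤o M N le))) y≮x
  ...   | inj₂ eq = contradiction
    (½ ℚ.* ε , half-pos 0<ε , M ⊔ N , λ m le′ →
      separated (seq x n) (seq y n) (seq x m) (seq y m)
        (subst (ε ℚ.≤_) (trans eq
           (solve 2 (λ a b → :- (a :- b) := b :- a) refl (seq x n) (seq y n)))
           (ℚ.≮⇒≥ ≮ε))
        (q n m (ℕ.m⊔n≤o⇒n≤o M N le) (ℕ.m⊔n≤o⇒n≤o M N le′))
        (p m n (ℕ.m⊔n≤o⇒m≤o M N le′) (ℕ.m⊔n≤o⇒m≤o M N le))) x≮y

-‿cong : ∀ x y → x ≈ y → (- x) ≈ (- y)
-‿cong x y x≈y ε 0<ε = map-eventually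
  (λ n → subst (ℚ._< ε) (trans (∣p-q∣≡∣q-p∣ (seq x n) (seq y n)) (cong ∣_∣
    (solve 2 (λ a b → b :- a := :- a :- (:- b)) refl (seq x n) (seq y n)))))
  (x≈y ε 0<ε)

+-cong : ∀ x x′ y y′ → x ≈ x′ → y ≈ y′ → (x + y) ≈ (x′ + y′)
+-cong x x′ y y′ x≈x′ y≈y′ ε 0<ε = map-eventually
  (λ n (p , q) → subst (λ d → ∣ d ∣ ℚ.< ε)
    (solve 4 (λ a a′ b b′ → (a :- a′) :+ (b :- b′) := (a :+ b) :- (a′ :+ b′)) refl
      (seq x n) (seq x′ n) (seq y n) (seq y′ n))
    (add-halves _ _ p q))
  (eventually-× (x≈x′ _ (half-pos 0<ε)) (y≈y′ _ (half-pos 0<ε)))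

x-y-cong : ∀ x x′ y y′ → x ≈ x′ → y ≈ y′ → (x - y) ≈ (x′ - y′)
x-y-cong x x′ y y′ x≈x′ y≈y′ = +-cong x x′ (- y) (- y′) x≈x′ (-‿cong y y′ y≈y′)

-‿anti-< : ∀ x y → x < y → (- y) < (- x)
-‿anti-< x y (ε , 0<ε , x<y) = ε , 0<ε , map-eventually
  (λ n p → subst₂ ℚ._≤_
    (solve 3 (λ a b e → (a :+ e) :+ (:- a :- b) := :- b :+ e) refl (seq x n) (seq y n) ε)
    (solve 2 (λ a b → b :+ (:- a :- b) := :- a) refl (seq x n) (seq y n))
    (ℚ.+-monoˡ-≤ (ℚ.- seq x n ℚ.- seq y n) p)) x<y

0<⇒-<0 : ∀ x → 0ℝ < x → (- x) < 0ℝ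
0<⇒-<0 x (ε , 0<ε , 0<x) = ε , 0<ε , map-eventually
  (λ n p → subst₂ ℚ._≤_
    (solve 2 (λ a e → (con 0ℚ :+ e) :- a := :- a :+ e) refl (seq x n) ε)
    (ℚ.+-inverseʳ (seq x n))
    (ℚ.+-monoˡ-≤ (ℚ.- seq x n) p)) 0<x

x-r<x : ∀ x r → 0ℝ < r → (x - r) < x
x-r<x x r (ε , 0<ε , 0<r) = ε , 0<ε , map-eventually
  (λ n p → subst₂ ℚ._≤_
    (solve 3 (λ a b e → (con 0ℚ :+ e) :+ (a :- b) := (a :- b) :+ e) refl
      (seq x n) (seq r n) ε)
    (solve 2 (λ a b → b :+ (a :- b) := a) refl (seq x n) (seq r n))
    (ℚ.+-monoˡ-≤ (seq x n ℚ.- seq r n) p)) 0<r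

-‿cancel-< : ∀ x x′ r r′ → (x - r) < (x′ - r′) → x′ < x → r′ < r
-‿cancel-< x x′ r r′ (ε , 0<ε , p) (δ , 0<δ , q) = ε , 0<ε , map-eventually
  (λ n (p , q) → subst₂ ℚ._≤_
    (solve 5 (λ a a′ b b′ e → ((a :- b) :+ e) :+ a′ :+ (b :+ b′ :- a :- a′) := b′ :+ e) refl
      (seq x n) (seq x′ n) (seq r n) (seq r′ n) ε)
    (solve 4 (λ a a′ b b′ → (a′ :- b′) :+ a :+ (b :+ b′ :- a :- a′) := b) refl
      (seq x n) (seq x′ n) (seq r n) (seq r′ n))
    (ℚ.+-monoˡ-≤ (seq r n ℚ.+ seq r′ n ℚ.- seq x n ℚ.- seq x′ n)
      (ℚ.+-mono-≤ p (ℚ.≤-trans (p≤p+ε (seq x′ n) 0<δ) q))))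
  (eventually-× p q)

-‿cancelˡ-< : ∀ x r r′ → (x - r) < (x - r′) → r′ < r
-‿cancelˡ-< x r r′ (ε , 0<ε , p) = ε , 0<ε , map-eventually
  (λ n p → subst₂ ℚ._≤_
    (solve 4 (λ a b b′ e → ((a :- b) :+ e) :+ (b :+ b′ :- a) := b′ :+ e) refl
      (seq x n) (seq r n) (seq r′ n) ε)
    (solve 3 (λ a b b′ → (a :- b′) :+ (b :+ b′ :- a) := b) refl
      (seq x n) (seq r n) (seq r′ n))
    (ℚ.+-monoˡ-≤ (seq r n ℚ.+ seq r′ n ℚ.- seq x n) p))
  p

-- The Archimedean property and rational bounds

infix 8 _·_

-- Iterated addition, so that `suc n · δ` unfolds to the form `δ ℚ.+ q` that `shift-bound` consumes.
_·_ : ℕ → ℚ → ℚ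
zero  · δ = 0ℚ
suc n · δ = δ ℚ.+ n · δ

fromℕ : ℕ → ℚ
fromℕ n = ℚ.fromℚᵘ (mkℚᵘ (+ n) 0)

fromℕ-suc : ∀ n → fromℕ (suc n) ≡ 1ℚ ℚ.+ fromℕ n
fromℕ-suc n = ℚ.toℚᵘ-injective (ℚᵘ.≃-trans (ℚ.toℚᵘ-fromℚᵘ (mkℚᵘ (+ suc n) 0))
  (ℚᵘ.≃-sym (ℚᵘ.≃-trans (ℚ.toℚᵘ-homo-+ 1ℚ (fromℕ n))
    (ℚᵘ.≃-trans (ℚᵘ.+-congʳ (mkℚᵘ (+ 1) 0) (ℚ.toℚᵘ-fromℚᵘ (mkℚᵘ (+ n) 0)))
      (*≡* (cong (λ i → (+ 1 ℤ.+ i) ℤ.* + 1) (ℤ.*-identityʳ (+ n))))))))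

·-fromℕ : ∀ n δ → fromℕ n ℚ.* δ ≡ n · δ
·-fromℕ zero    δ = ℚ.*-zeroˡ δ
·-fromℕ (suc n) δ = trans (cong (ℚ._* δ) (fromℕ-suc n))
  (trans (solve 2 (λ m d → (con 1ℚ :+ m) :* d := d :+ m :* d) refl (fromℕ n) δ)
         (cong (δ ℚ.+_) (·-fromℕ n δ)))

-- The denominator is at least 1, so dropping it does not decrease the absolute value.
p≤fromℕ∣↥p∣ : ∀ p → p ℚ.≤ fromℕ ℤ.∣ ↥ p ∣
p≤fromℕ∣↥p∣ p@(mkℚ i d _) = ℚ.toℚᵘ-cancel-≤ (ℚᵘ.≤-respʳ-≃
  (ℚᵘ.≃-sym (ℚ.toℚᵘ-fromℚᵘ (mkℚᵘ (+ ℤ.∣ ↥ p ∣) 0))) (*≤* (bound i d)))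
  where
  bound : ∀ i d → i ℤ.* + 1 ℤ.≤ + ℤ.∣ i ∣ ℤ.* + suc d
  bound (+ n)      d = subst₂ ℤ._≤_ (ℤ.pos-* n 1) (ℤ.pos-* n (suc d))
                         (ℤ.+≤+ (ℕ.*-monoʳ-≤ n (ℕ.s≤s ℕ.z≤n)))
  bound ℤ.-[1+ n ] d = ℤ.-≤+

archimedean : ∀ q {δ} → 0ℚ ℚ.< δ → ∃[ n ] q ℚ.≤ n · δ
archimedean q {δ} 0<δ = n , subst₂ ℚ._≤_
  (trans (ℚ.*-assoc q (ℚ.1/ δ) δ) (trans (cong (q ℚ.*_) (ℚ.*-inverseˡ δ)) (ℚ.*-identityʳ q)))
  (·-fromℕ n δ)
  (ℚ.*-monoʳ-≤-nonNeg δ (p≤fromℕ∣↥p∣ (q ℚ.* ℚ.1/ δ)))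
  where
  instance
    δ-pos : ℚ.Positive δ
    δ-pos = ℚ.positive 0<δ
    δ-nonNeg : ℚ.NonNegative δ
    δ-nonNeg = ℚ.pos⇒nonNeg δ
    δ-nonZero : ℚ.NonZero δ
    δ-nonZero = ℚ.pos⇒nonZero δ
  n = ℤ.∣ ↥ (q ℚ.* ℚ.1/ δ) ∣

⌜_⌝ : ℚ → ℝ
⌜ q ⌝ = mkℝ (λ _ → q) λ ε 0<ε → 0 , λ _ _ _ _ → subst (ℚ._< ε) (sym (∣p-p∣≡0 q)) 0<ε

bounded : ∀ x → ∃[ q ] x < ⌜ q ⌝
bounded x with N , close ← cauchy x 1ℚ (ℚ.positive⁻¹ 1ℚ) =
  -- The first 1 absorbs the Cauchy error, the second is the gap demanded by `_<_`.
  seq x N ℚ.+ 1ℚ ℚ.+ 1ℚ , 1ℚ , ℚ.positive⁻¹ 1ℚ , N , λ n N≤n →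
    ℚ.+-monoˡ-≤ 1ℚ (subst (ℚ._≤ seq x N ℚ.+ 1ℚ)
      (solve 2 (λ a b → b :+ (a :- b) := a) refl (seq x n) (seq x N))
      (ℚ.+-monoʳ-≤ (seq x N) (ℚ.<⇒≤ (ℚ.≤-<-trans (p≤∣p∣ _) (close n N N≤n ℕ.≤-refl)))))

-- The rational witness of `0ℝ < r` serves for all `x` and `q` at once: each subtraction of `r`
-- takes one `δ` off a rational upper bound.
shift-bound : ∀ r → 0ℝ < r → ∃[ δ ] (0ℚ ℚ.< δ ×
  (∀ x q → x < ⌜ δ ℚ.+ q ⌝ → (x - r) < ⌜ q ⌝))
shift-bound r (δ , 0<δ , δ≤r) = δ , 0<δ , λ x q (ε , 0<ε , x<δ+q) →
  ε , 0<ε , map-eventually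
    (λ n (p , p′) → subst₂ ℚ._≤_
      (solve 4 (λ a b d e → (con 0ℚ :+ d) :+ (a :+ e) :+ (:- d :- b) := (a :- b) :+ e) refl
        (seq x n) (seq r n) δ ε)
      (solve 3 (λ b d q → b :+ (d :+ q) :+ (:- d :- b) := q) refl (seq r n) δ q)
      (ℚ.+-monoˡ-≤ (ℚ.- δ ℚ.- seq r n) (ℚ.+-mono-≤ p p′)))
    (eventually-× δ≤r x<δ+q)

-- Sequences and subsequences

dependent-choice : ∀ {A : Set} {R : A → A → Set} → (∀ a → ∃[ b ] R a b) → A →
  Σ[ x ∈ (ℕ → A) ] (∀ n → R (x n) (x (suc n)))
-- The existential is a Σ-type, so `next` already selects a successor and is simply iterated.
dependent-choice {A} next a = x , λ n → proj₂ (next (x n))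
  where
  x : ℕ → A
  x zero    = a
  x (suc n) = proj₁ (next (x n))

Increasing : (ℕ → ℕ) → Set
Increasing φ = ∀ n → φ n ℕ.< φ (suc n)

Decreasing : (ℕ → ℝ) → Set
Decreasing x = ∀ n → x (suc n) < x n

decreasing-< : ∀ {x} → Decreasing x → ∀ {m n} → m ℕ.< n → x n < x m
decreasing-< {x} dec {m} {suc n} (ℕ.s≤s m≤n) with ℕ.m≤n⇒m<n∨m≡n m≤n
... | inj₁ m<n  = <-trans (x (suc n)) (x n) (x m) (dec n) (decreasing-< {x} dec m<n)
... | inj₂ refl = dec n

subsequence : ∀ {x} → Decreasing x → ∀ {φ} → Increasing φ → Decreasing (x ∘ φ)
subsequence {x} dec inc n = decreasing-< {x} dec (inc n)

-- Classical logic: Ramsey, trichotomy, descent in [0, ∞)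

module Classical (em : ExcludedMiddle 0ℓ) where

  ¬∀⇒∃¬ : ∀ {A : Set} {P : A → Set} → ¬ (∀ a → P a) → ∃[ a ] ¬ P a
  ¬∀⇒∃¬ {A} {P} ¬all with em {∃[ a ] ¬ P a}
  ... | yes found = found
  ... | no  none  = contradiction (λ a → decidable-stable em λ ¬Pa → none (a , ¬Pa)) ¬all

  ¬→⇒×¬ : ∀ {A B : Set} → ¬ (A → B) → A × ¬ B
  ¬→⇒×¬ ¬f = ¬∀⇒∃¬ ¬f

  -- n is a peak if R n m for all m > n: either there are infinitely many
  -- peaks, or beyond the last one every n has a later m with ¬ R n m.
  ramsey : (R : ℕ → ℕ → Set) → Σ[ φ ∈ (ℕ → ℕ) ] (Increasing φ ×
    ((∀ n → R (φ n) (φ (suc n))) ⊎ (∀ n → ¬ R (φ n) (φ (suc n)))))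
  ramsey R with em {∀ N → ∃[ n ] (N ≤ℕ n × (∀ m → n ℕ.< m → R n m))}
  ... | yes peaks with φ , step ← dependent-choice
        {A = ∃[ n ] (∀ m → n ℕ.< m → R n m)} {R = λ a b → proj₁ a ℕ.< proj₁ b}
        (λ (n , _) → let m , n<m , peak = peaks (suc n) in (m , peak) , n<m)
        (let n , _ , peak = peaks 0 in n , peak)
      = proj₁ ∘ φ , step , inj₁ λ n → proj₂ (φ n) _ (step n)
  ramsey R | no ¬peaks with N , no-peak ← ¬∀⇒∃¬ ¬peaks
    with φ , step ← dependent-choice
        {A = ∃[ n ] N ≤ℕ n} {R = λ a b → proj₁ a ℕ.< proj₁ b × ¬ R (proj₁ a) (proj₁ b)}
        (λ (n , N≤n) →
          let m , ¬p = ¬∀⇒∃¬ λ peak → no-peak (n , N≤n , peak)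
              n<m , ¬R = ¬→⇒×¬ ¬p
          in (m , ℕ.≤-trans N≤n (ℕ.<⇒≤ n<m)) , n<m , ¬R)
        (N , ℕ.≤-refl)
      = proj₁ ∘ φ , proj₁ ∘ step , inj₂ (proj₂ ∘ step)

  compare : ∀ x y → x < y ⊎ x ≈ y ⊎ y < x
  compare x y with em {x < y} | em {y < x}
  ... | yes x<y | _       = inj₁ x<y
  ... | no _    | yes y<x = inj₂ (inj₂ y<x)
  ... | no x≮y  | no y≮x  = inj₂ (inj₁ (≮∧≯⇒≈ x y x≮y y≮x))

  ≮∧≉⇒> : ∀ x y → ¬ (x < y) → ¬ (x ≈ y) → y < x
  ≮∧≉⇒> x y x≮y x≉y = decidable-stable em λ y≮x → x≉y (≮∧≯⇒≈ x y x≮y y≮x)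

  <-respˡ-≈ : ∀ x x′ y → x ≈ x′ → x < y → x′ < y
  <-respˡ-≈ x x′ y x≈x′ x<y with compare x′ y
  ... | inj₁ x′<y        = x′<y
  ... | inj₂ (inj₁ x′≈y) = contradiction x<y (<-irrefl x y (≈-trans {x} {x′} {y} x≈x′ x′≈y))
  ... | inj₂ (inj₂ y<x′) = contradiction (<-trans x y x′ x<y y<x′) (<-irrefl x x′ x≈x′)

  <-respʳ-≈ : ∀ x y y′ → y ≈ y′ → x < y → x < y′
  <-respʳ-≈ x y y′ y≈y′ x<y with compare x y′
  ... | inj₁ x<y′        = x<y′
  ... | inj₂ (inj₁ x≈y′) = contradiction x<y
    (<-irrefl x y (≈-trans {x} {y′} {y} x≈y′ (≈-sym {y} {y′} y≈y′)))
  ... | inj₂ (inj₂ y′<x) = contradiction (<-trans y′ x y y′<x x<y)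
    (<-irrefl y′ y (≈-sym {y} {y′} y≈y′))

  ≤-<-trans : ∀ x y z → y ≥ x → y < z → x < z
  ≤-<-trans x y z y≥x y<z with compare x y
  ... | inj₁ x<y        = <-trans x y z x<y y<z
  ... | inj₂ (inj₁ x≈y) = <-respˡ-≈ y x z (≈-sym {x} {y} x≈y) y<z
  ... | inj₂ (inj₂ y<x) = contradiction y<x y≥x

  <-≤-trans : ∀ x y z → x < y → z ≥ y → x < z
  <-≤-trans x y z x<y z≥y with compare y z
  ... | inj₁ y<z        = <-trans x y z x<y y<z
  ... | inj₂ (inj₁ y≈z) = <-respʳ-≈ x y z y≈z x<y
  ... | inj₂ (inj₂ z<y) = contradiction z<y z≥y

  ≥-trans : ∀ x y z → x ≥ y → y ≥ z → x ≥ z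
  ≥-trans x y z x≥y y≥z x<z = y≥z (≤-<-trans y x z x≥y x<z)

  -- If `x 0` lies below `N · δ` with `δ` a rational lower bound of `r`, each step lowers the bound
  -- by `δ`, and `x N` would be negative.
  no-uniform-descent : (x : ℕ → ℝ) → (∀ n → x n ≥ 0ℝ) → ∀ r → 0ℝ < r →
    ¬ (∀ n → (x n - r) ≥ x (suc n))
  no-uniform-descent x x≥0 r 0<r descent =
    let δ , 0<δ , shift = shift-bound r 0<r
        q , ε , 0<ε , x₀<q = bounded (x 0)
        N , q≤Nδ = archimedean q 0<δ
    in x≥0 N (reach δ shift N 0
         (ε , 0<ε , map-eventually (λ n p → ℚ.≤-trans p q≤Nδ) x₀<q))
    where
    reach : ∀ δ → (∀ x q → x < ⌜ δ ℚ.+ q ⌝ → (x - r) < ⌜ q ⌝) →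
            ∀ n k → x k < ⌜ n · δ ⌝ → x (k ℕ.+ n) < 0ℝ
    reach δ shift zero    k x<0 = subst (λ i → x i < 0ℝ) (sym (ℕ.+-identityʳ k)) x<0
    reach δ shift (suc n) k x<δ+nδ = subst (λ i → x i < 0ℝ) (sym (ℕ.+-suc k n))
      (reach δ shift n (suc k) (≤-<-trans (x (suc k)) (x k - r) ⌜ n · δ ⌝ (descent k)
        (shift (x k) (n · δ) x<δ+nδ)))

  -- Every `r n` has a smaller later term: otherwise all steps after `n` have length at least `r n`,
  -- contradicting `no-uniform-descent` on the tail from `suc n`.
  decreasing-steps : (x r : ℕ → ℝ) → (∀ n → x n ≥ 0ℝ) → (∀ n → 0ℝ < r n) →
    (∀ n → (x n - r n) ≥ x (suc n)) →
    Σ[ φ ∈ (ℕ → ℕ) ] (Increasing φ × Decreasing (r ∘ φ))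
  decreasing-steps x r x≥0 0<r descent =
    let φ , step = dependent-choice {R = λ n m → n ℕ.< m × r m < r n} later 0
    in φ , proj₁ ∘ step , proj₂ ∘ step
    where
    later : ∀ n → ∃[ m ] (n ℕ.< m × r m < r n)
    later n = decidable-stable em λ none →
      no-uniform-descent (λ i → x (i ℕ.+ suc n)) (λ i → x≥0 (i ℕ.+ suc n)) (r n) (0<r n)
        λ i lt → none (i ℕ.+ suc n , ℕ.m≤n+m (suc n) i ,
          -‿cancelˡ-< (x (i ℕ.+ suc n)) (r n) (r (i ℕ.+ suc n))
            (<-≤-trans (x (i ℕ.+ suc n) - r n) (x (suc i ℕ.+ suc n))
              (x (i ℕ.+ suc n) - r (i ℕ.+ suc n)) lt (descent (i ℕ.+ suc n))))

-- Evaluation: determinacy, positivity, good points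

module Evaluation {k : ℕ} (f : RealFunction Negative)
                  (gs : Vec (RealFunction Negative) k)
                  (s : RealFunction NonNegative) where
  open Algorithm f gs s
  open Func using (to)

  mutual
    -- The sign of the argument fixes the constructor, and `≈` preserves sign. This yields both
    -- uniqueness of values and the congruence of `M`.
    ⇓-cong : (em : ExcludedMiddle 0ℓ) → ∀ {x x′ y y′} →
             x ≈ x′ → x ⇓ y → x′ ⇓ y′ → y ≈ y′
    ⇓-cong em x≈x′ (base p) (base p′) = Func.cong f x≈x′
    ⇓-cong em {x} {x′} x≈x′ (base x<0) (step x′≥0 _) =
      contradiction (Classical.<-respˡ-≈ em x x′ 0ℝ x≈x′ x<0) x′≥0
    ⇓-cong em {x} {x′} x≈x′ (step x≥0 _) (base x′<0) =
      contradiction (Classical.<-respˡ-≈ em x′ x 0ℝ (≈-sym {x} {x′} x≈x′) x′<0) x≥0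
    ⇓-cong em x≈x′ (step _ e) (step _ e′) = Nested-cong em x≈x′ e e′

    Nested-cong : (em : ExcludedMiddle 0ℓ) → ∀ {n} {hs : Vec _ n} {x x′ x≥0 x′≥0 y y′} →
                  x ≈ x′ → Nested x x≥0 hs y → Nested x′ x′≥0 hs y′ → y ≈ y′
    Nested-cong em x≈x′ innermost innermost = Func.cong s x≈x′
    Nested-cong em {x = x} {x′} x≈x′ (apply {r = r} {m} {g} e c _) (apply {r = r′} {m′} e′ c′ _) =
      Func.cong g (-‿cong m m′ (⇓-cong em
        (x-y-cong x x′ r r′ x≈x′ (Nested-cong em x≈x′ e e′)) c c′))

  module Positivity (f-pos : Positive f) (gs-pos : All Positive gs) (s-pos : Positive s) where

    -- The last function applied is `s` or some `g`. Positivity keeps `- m` in the domain of the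
    -- next function and makes every recursive call go strictly to the left.
    Nested-pos : ∀ {n} {hs : Vec _ n} {x x≥0 y} → All Positive hs → Nested x x≥0 hs y → 0ℝ < y
    Nested-pos []      innermost       = s-pos _
    Nested-pos (p ∷ _) (apply _ _ -m<0) = p (_ , -m<0)

    ⇓-pos : ∀ {x y} → x ⇓ y → 0ℝ < y
    ⇓-pos (base x<0) = f-pos (_ , x<0)
    ⇓-pos (step _ e) = Nested-pos gs-pos e

  -- Phrased through evaluations because `M` is not yet known to be total.
  BadRunFrom : ℝ → Set
  BadRunFrom x₀ = Σ[ x ∈ (ℕ → ℝ) ] Σ[ m ∈ (ℕ → ℝ) ]
    (x₀ ≥ x 0 × (∀ n → x n ⇓ m n) × Decreasing x × Decreasing m)

  Good : ℝ → Set
  Good x = (∀ y → x ≥ y → Halts y) × ¬ BadRunFrom x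

  -- Defined by recursion on the vector, so that the intermediate values can be
  -- projected out of a whole sequence of evaluations.
  Safely : ∀ x → NonNegative x → ∀ {n} → Vec (RealFunction Negative) n → ℝ → Set
  Safely x x≥0 []       y = to s (x , x≥0) ≡ y
  Safely x x≥0 (g ∷ hs) y = Σ[ r ∈ ℝ ] Σ[ m ∈ ℝ ] (Safely x x≥0 hs r × Good (x - r) ×
    x - r ⇓ m × Σ[ -m<0 ∈ Negative (- m) ] to g (- m , -m<0) ≡ y)

  Safely⇒Nested : ∀ {x x≥0 n} (hs : Vec _ n) {y} → Safely x x≥0 hs y → Nested x x≥0 hs y
  Safely⇒Nested []       refl = innermost
  Safely⇒Nested (g ∷ hs) (_ , _ , safe , _ , call , -m<0 , refl) =
    apply (Safely⇒Nested hs safe) call -m<0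

  -- Descending values along safe evaluations

  module _ (em : ExcludedMiddle 0ℓ) where
    open Classical em

    module _ (s-od : OrdinalDecreasing s) where

      -- Induction on `hs`, stripping the outermost function. Goodness is asked only of the points
      -- actually called, so this applies before all points are known to be good.
      no-safe-descent : ∀ {n} (hs : Vec _ n) → All OrdinalDecreasing hs →
        (x r : ℕ → ℝ) (x≥0 : ∀ n → NonNegative (x n)) →
        (∀ n → Safely (x n) (x≥0 n) hs (r n)) → Decreasing x → ¬ Decreasing r
      no-safe-descent [] [] x r x≥0 safe x-dec r-dec =
        s-od ((λ n → x n , x≥0 n) , x-dec ,
          λ n → subst₂ _<_ (sym (safe (suc n))) (sym (safe n)) (r-dec n))
      no-safe-descent (g ∷ hs) (g-od ∷ hs-od) x r x≥0 safe x-dec r-dec =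
        outer (ramsey λ i j → m i < m j)
        where
        r′ m b : ℕ → ℝ
        r′ n = proj₁ (safe n)
        m n  = proj₁ (proj₂ (safe n))
        b n  = x n - r′ n
        safe′ : ∀ n → Safely (x n) (x≥0 n) hs (r′ n)
        safe′ n = proj₁ (proj₂ (proj₂ (safe n)))
        good : ∀ n → Good (b n)
        good n = proj₁ (proj₂ (proj₂ (proj₂ (safe n))))
        call : ∀ n → b n ⇓ m n
        call n = proj₁ (proj₂ (proj₂ (proj₂ (proj₂ (safe n)))))
        arg<0 : ∀ n → Negative (- m n)
        arg<0 n = proj₁ (proj₂ (proj₂ (proj₂ (proj₂ (proj₂ (safe n))))))
        value : ∀ n → to g (- m n , arg<0 n) ≡ r n
        value n = proj₂ (proj₂ (proj₂ (proj₂ (proj₂ (proj₂ (safe n))))))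

        inner : ∀ φ → Increasing φ → Decreasing (m ∘ φ) →
                Σ[ ψ ∈ (ℕ → ℕ) ] (Increasing ψ ×
                  ((∀ n → b (φ (ψ (suc n))) < b (φ (ψ n))) ⊎
                   (∀ n → ¬ (b (φ (ψ (suc n))) < b (φ (ψ n)))))) → ⊥
        -- Call points and their values decrease together: a bad run from a good point.
        inner φ φ-inc m-dec (ψ , ψ-inc , inj₁ down) =
          proj₂ (good (φ (ψ 0)))
            (b ∘ φ ∘ ψ , m ∘ φ ∘ ψ , ≥-refl (b (φ (ψ 0))) ,
             call ∘ φ ∘ ψ , down , subsequence {m ∘ φ} m-dec ψ-inc)
        -- Equal call points would have equal values, so the `b` strictly increase; as `x`
        -- decreases, `r′` must decrease too.
        inner φ φ-inc m-dec (ψ , ψ-inc , inj₂ ¬down) =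
          no-safe-descent hs hs-od (x ∘ χ) (r′ ∘ χ) (x≥0 ∘ χ) (safe′ ∘ χ) xχ-dec
            λ n → -‿cancel-< (x (χ n)) (x (χ (suc n))) (r′ (χ n)) (r′ (χ (suc n)))
              (≮∧≉⇒> (b (χ (suc n))) (b (χ n)) (¬down n) (λ b≈ →
                <-irrefl (m (χ (suc n))) (m (χ n))
                  (⇓-cong em b≈ (call (χ (suc n))) (call (χ n)))
                  (subsequence {m ∘ φ} m-dec ψ-inc n)))
              (xχ-dec n)
          where
          χ = φ ∘ ψ
          xχ-dec : Decreasing (x ∘ χ)
          xχ-dec = subsequence {x ∘ φ} (subsequence {x} x-dec φ-inc) ψ-inc

        outer : Σ[ φ ∈ (ℕ → ℕ) ] (Increasing φ ×
                  ((∀ n → m (φ n) < m (φ (suc n))) ⊎ (∀ n → ¬ (m (φ n) < m (φ (suc n)))))) → ⊥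
        -- The arguments `- m` decrease along with the values of `g`: a `g`-bad sequence.
        outer (φ , φ-inc , inj₁ up) =
          g-od ((λ n → - m (φ n) , arg<0 (φ n)) ,
            (λ n → -‿anti-< (m (φ n)) (m (φ (suc n))) (up n)) ,
            λ n → subst₂ _<_ (sym (value (φ (suc n)))) (sym (value (φ n)))
              (subsequence {r} r-dec φ-inc n))
        -- Consecutive equal `m` would give equal `r`, so `m` strictly decreases.
        outer (φ , φ-inc , inj₂ ¬up) =
          inner φ φ-inc
            (λ n → ≮∧≉⇒> (m (φ n)) (m (φ (suc n))) (¬up n) (λ m≈ →
              <-irrefl (r (φ (suc n))) (r (φ n))
                (≈-sym {r (φ n)} {r (φ (suc n))}
                  (subst₂ _≈_ (value (φ n)) (value (φ (suc n)))
                    (Func.cong g (-‿cong (m (φ n)) (m (φ (suc n))) m≈))))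
                (subsequence {r} r-dec φ-inc n)))
            (ramsey λ i j → b (φ j) < b (φ i))

    -- Every point is good

    module _ (f-od : OrdinalDecreasing f) (f-pos : Positive f)
             (gs-od : All OrdinalDecreasing gs) (gs-pos : All Positive gs)
             (s-od : OrdinalDecreasing s) (s-pos : Positive s) where
      open Positivity f-pos gs-pos s-pos

      -- Left of 0 every value is a value of `f`, so a bad run there is `f`-bad. This disposes of
      -- runs that cross below 0.
      Negative⇒Good : ∀ {x} → Negative x → Good x
      Negative⇒Good {x} x<0 =
        (λ y x≥y → _ , base (≤-<-trans y x 0ℝ x≥y x<0)) ,
        λ (u , m , x≥u₀ , evals , u-dec , m-dec) →
          let u<0 : ∀ n → Negative (u n)
              u<0 = λ { zero    → ≤-<-trans (u 0) x 0ℝ x≥u₀ x<0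
                      ; (suc n) → <-trans (u (suc n)) (u 0) 0ℝ
                          (decreasing-< {u} u-dec (ℕ.s≤s ℕ.z≤n))
                          (≤-<-trans (u 0) x 0ℝ x≥u₀ x<0) }
              value : ∀ n → m n ≈ to f (u n , u<0 n)
              value n = ⇓-cong em (≈-refl {u n}) (evals n) (base (u<0 n))
          in f-od ((λ n → u n , u<0 n) , u-dec , λ n →
               <-respˡ-≈ (m (suc n)) (to f (u (suc n) , u<0 (suc n))) (to f (u n , u<0 n))
                 (value (suc n))
                 (<-respʳ-≈ (m (suc n)) (m n) (to f (u n , u<0 n)) (value n) (m-dec n)))

      -- Alternating stages of one induction: `good-below` leads from `SafelyBelow hs` to
      -- `GoodBelow hs`, which in turn yields `SafelyBelow (g ∷ hs)`.
      SafelyBelow GoodBelow : ∀ {n} → Vec (RealFunction Negative) n → ℝ → Set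
      SafelyBelow hs x₁ = ∀ x → x₁ ≥ x → (x≥0 : NonNegative x) →
        ∃[ r ] Safely x x≥0 hs r
      GoodBelow hs x₁ = ∀ x → x₁ ≥ x → (x≥0 : NonNegative x) →
        ∃[ r ] (Safely x x≥0 hs r × Good (x - r))

      -- Otherwise there are x₁ > x₂ > ⋯ ≥ 0 with xₙ₊₁ ≤ xₙ - rₙ, where rₙ is the
      -- value of the subexpression hs at xₙ.  The positive rₙ have a bounded sum,
      -- hence a strictly decreasing subsequence.
      good-below : ∀ {n} (hs : Vec _ n) → All OrdinalDecreasing hs → All Positive hs →
        ∀ {x₁} → ¬ Good x₁ → SafelyBelow hs x₁ → ∃[ x₂ ] (¬ Good x₂ × GoodBelow hs x₂)
      good-below hs hs-od hs-pos {x₁} ¬good₁ safely = decidable-stable em λ none →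
        -- A node is a point `y` that is not good. As `GoodBelow hs y` fails, some `x` at or below
        -- `y` calls a point `x - r` that is not good, and this is the next node.
        let Node = ∃[ y ] (¬ Good y × x₁ ≥ y)
            Edge : Node → Node → Set
            Edge (y , _) (y′ , _) = Σ[ x ∈ ℝ ] Σ[ x≥0 ∈ NonNegative x ] Σ[ r ∈ ℝ ]
              (y ≥ x × Safely x x≥0 hs r × y′ ≡ x - r)
            next : ∀ a → Σ[ a′ ∈ Node ] Edge a a′
            next = λ (y , ¬good , x₁≥y) →
              let (x , y≥x , x≥0) , ¬∃ = ¬∀⇒∃¬
                    {A = Σ[ x ∈ ℝ ] (y ≥ x × NonNegative x)}
                    {P = λ (x , _ , x≥0) → ∃[ r ] (Safely x x≥0 hs r × Good (x - r))}
                    λ all → none (y , ¬good , λ x y≥x x≥0 → all (x , y≥x , x≥0))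
                  x₁≥x = ≥-trans x₁ y x x₁≥y y≥x
                  r , safe = safely x x₁≥x x≥0
                  r>0 = Nested-pos hs-pos (Safely⇒Nested hs safe)
              in (x - r , (λ good → ¬∃ (r , safe , good)) ,
                  λ lt → x₁≥x (<-trans x₁ (x - r) x lt (x-r<x x r r>0))) ,
                 x , x≥0 , r , y≥x , safe , refl
            path , edge = dependent-choice {R = Edge} next
              (x₁ , ¬good₁ , ≥-refl x₁)
        in no-path path edge
        where
        no-path : (path : ℕ → ∃[ y ] (¬ Good y × x₁ ≥ y)) →
          (∀ n → Σ[ x ∈ ℝ ] Σ[ x≥0 ∈ NonNegative x ] Σ[ r ∈ ℝ ]
            (proj₁ (path n) ≥ x × Safely x x≥0 hs r × proj₁ (path (suc n)) ≡ x - r)) → ⊥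
        no-path path edge =
          let φ , φ-inc , rφ-dec = decreasing-steps x r x≥0 r>0 descent
          in no-safe-descent s-od hs hs-od (x ∘ φ) (r ∘ φ) (x≥0 ∘ φ) (safe ∘ φ)
               (subsequence {x} x-dec φ-inc) rφ-dec
          where
          x r : ℕ → ℝ
          x n = proj₁ (edge n)
          r n = proj₁ (proj₂ (proj₂ (edge n)))
          x≥0 : ∀ n → NonNegative (x n)
          x≥0 n = proj₁ (proj₂ (edge n))
          safe : ∀ n → Safely (x n) (x≥0 n) hs (r n)
          safe n = proj₁ (proj₂ (proj₂ (proj₂ (proj₂ (edge n)))))
          r>0 : ∀ n → 0ℝ < r n
          r>0 n = Nested-pos hs-pos (Safely⇒Nested hs (safe n))
          -- The next `x` lies at or below the next node, which is `x n - r n`.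
          descent : ∀ n → (x n - r n) ≥ x (suc n)
          descent n = subst (_≥ x (suc n)) (proj₂ (proj₂ (proj₂ (proj₂ (proj₂ (edge n))))))
            (proj₁ (proj₂ (proj₂ (proj₂ (edge (suc n))))))
          x-dec : Decreasing x
          x-dec n = ≤-<-trans (x (suc n)) (x n - r n) (x n) (descent n)
            (x-r<x (x n) (r n) (r>0 n))

      -- `s` makes no calls. For `g ∷ hs`, goodness of the called point lets the call halt, and
      -- positivity of its value puts `- m` in the domain of `g`.
      safely-below : ∀ {n} (hs : Vec _ n) → All OrdinalDecreasing hs → All Positive hs →
        ∀ {x₀} → ¬ Good x₀ → ∃[ x₁ ] (¬ Good x₁ × SafelyBelow hs x₁)
      safely-below [] [] [] {x₀} ¬good = x₀ , ¬good , λ x _ x≥0 → to s (x , x≥0) , refl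
      safely-below (g ∷ hs) (_ ∷ hs-od) (_ ∷ hs-pos) {x₀} ¬good =
        let x₁ , ¬good₁ , safely = safely-below hs hs-od hs-pos {x₀} ¬good
            x₂ , ¬good₂ , below = good-below hs hs-od hs-pos {x₁} ¬good₁ safely
        in x₂ , ¬good₂ , λ x x₂≥x x≥0 →
          let r , safe , good = below x x₂≥x x≥0
              m , call = proj₁ good (x - r) (≥-refl (x - r))
          in _ , r , m , safe , good , call , 0<⇒-<0 m (⇓-pos call) , refl

      SafelyBelow⇒Good : ∀ {x₁} → SafelyBelow gs x₁ → Good x₁
      SafelyBelow⇒Good {x₁} safely = halts , no-bad
        where
        halts : ∀ y → x₁ ≥ y → Halts y
        halts y x₁≥y with em {Negative y}
        ... | yes y<0 = _ , base y<0
        ... | no  y≥0 = let r , safe = safely y x₁≥y y≥0 in r , step y≥0 (Safely⇒Nested gs safe)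

        no-bad : ¬ BadRunFrom x₁
        no-bad (u , m , x₁≥u₀ , evals , u-dec , m-dec) with em {∃[ n ] Negative (u n)}
        -- The tail of the run from index `N` lies entirely left of 0.
        ... | yes (N , uN<0) = proj₂ (Negative⇒Good {u N} uN<0)
          ((λ n → u (n ℕ.+ N)) , (λ n → m (n ℕ.+ N)) ,
           ≥-refl (u N) ,
           (λ n → evals (n ℕ.+ N)) , (λ n → u-dec (n ℕ.+ N)) , λ n → m-dec (n ℕ.+ N))
        -- The run stays in [0, ∞). Its values agree with the safely computed ones only up to `≈`,
        -- so the decrease is transferred along `m≈r`.
        ... | no none = no-safe-descent s-od gs gs-od u r u≥0 (λ n → proj₂ (safe n)) u-dec
          λ n → <-respˡ-≈ (m (suc n)) (r (suc n)) (r n) (m≈r (suc n))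
                  (<-respʳ-≈ (m (suc n)) (m n) (r n) (m≈r n) (m-dec n))
          where
          u≥0 : ∀ n → NonNegative (u n)
          u≥0 n lt = none (n , lt)
          x₁≥u : ∀ n → x₁ ≥ u n
          x₁≥u zero    = x₁≥u₀
          x₁≥u (suc n) lt = x₁≥u n (<-trans x₁ (u (suc n)) (u n) lt (u-dec n))
          safe : ∀ n → ∃[ r ] Safely (u n) (u≥0 n) gs r
          safe n = safely (u n) (x₁≥u n) (u≥0 n)
          r : ℕ → ℝ
          r n = proj₁ (safe n)
          m≈r : ∀ n → m n ≈ r n
          m≈r n = ⇓-cong em (≈-refl {u n}) (evals n)
            (step (u≥0 n) (Safely⇒Nested gs (proj₂ (safe n))))

      all-good : ∀ x → Good x
      all-good x = decidable-stable em λ ¬good →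
        let x₁ , ¬good₁ , safely = safely-below gs gs-od gs-pos {x} ¬good
        in ¬good₁ (SafelyBelow⇒Good {x₁} safely)

theorem1 : ExcludedMiddle 0ℓ →
    ∀ (k : ℕ) → 1 ≤ℕ k →
    (f : RealFunction Negative)
    (gs : Vec (RealFunction Negative) k)
    (s : RealFunction NonNegative) →
    OrdinalDecreasing f → Positive f →
    All OrdinalDecreasing gs → All Positive gs →
    OrdinalDecreasing s → Positive s →
    let open Algorithm f gs s in
    (∀ x → Halts x) × (∃[ M ] (Computes M × OrdinalDecreasing M))
theorem1 em k _ f gs s f-od f-pos gs-od gs-pos s-od s-pos =
  halts ,
  record { to = λ (x , _) → proj₁ (halts x)
         ; cong = λ {(x , _)} {(y , _)} x≈y →
             ⇓-cong em x≈y (proj₂ (halts x)) (proj₂ (halts y)) } ,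
  (λ x → proj₂ (halts x) , λ y x⇓y → ⇓-cong em (≈-refl {x}) x⇓y (proj₂ (halts x))) ,
  -- An `M`-bad sequence is a bad run from its own first point.
  λ (u , u-dec , M-dec) → proj₂ (good (proj₁ (u 0)))
    (proj₁ ∘ u , (λ n → proj₁ (halts (proj₁ (u n)))) , ≥-refl (proj₁ (u 0)) ,
     (λ n → proj₂ (halts (proj₁ (u n)))) , u-dec , M-dec)
  where
  open Algorithm f gs s using (Halts)
  open Evaluation f gs s
  good : ∀ x → Good x
  good = all-good em f-od f-pos gs-od gs-pos s-od s-pos
  halts : ∀ x → Halts x
  halts x = proj₁ (good x) x (≥-refl x)
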